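{- Let $G$ be a connected non-bipartite graph. Then $\mathbb{S}(G)=\mathbb{S}_1(G)\cup\mathbb{S}_2(G)\cup\mathbb{S}_3(G)\cup\cdots$.
   Context: Graphs are finite and simple. A signed graph $\Gamma=(G,\sigma)$ on $G$ is $G$ with a function $\sigma:E(G)\to\{+1,-1\}$. Switching $\Gamma$ with respect to $U\subseteq V(G)$ reverses the signs of all edges between $U$ and $V(G)\setminus U$. $\Gamma\simeq\Gamma'$ (switching isomorphic) means $\Gamma$ is isomorphic, by a sign-preserving graph isomorphism, to a switching of $\Gamma'$. $\Gamma$ is sign-symmetric if $\Gamma\simeq-\Gamma$, where $-\Gamma=(G,-\sigma)$. $\mathbb{S}(G)$ is the set of all sign-symmetric signed graphs on $G$. The sign of a cycle is the product of the signs of its edges. A weak automorphism of $\Gamma$ is a $\varphi\in Aut(G)$ (automorphism of the unsigned graph) with $\sigma(\varphi(C))=-\sigma(C)$ for every odd cycle $C$ of $G$ and $\sigma(\varphi(C))=\sigma(C)$ for every even cycle $C$. A weak automorphism of $\Gamma$ is principal (a PWA) if it has the smallest order among all weak automorphisms of $\Gamma$. For an integer $r\ge1$, $\mathbb{S}_r(G)=\{\Gamma\in\mathbb{S}(G)\mid \Gamma \text{ has a principal weak automorphism of order } 2r\}$. -}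

module Defs where

open import Data.Bool using (Bool; T; if_then_else_; _xor_)
open import Data.Fin using (Fin)
open import Data.Fin.Permutation using (Permutation; Permutation′; _⟨$⟩ʳ_; _∘ₚ_; _≈_; id)
open import Data.Fin.Subset using (Subset)
open import Data.List using (List; []; _∷_)
open import Data.List.Relation.Unary.Unique.Propositional using (Unique)
open import Data.Nat using (ℕ; zero; suc; _*_; _≤_; _<_)
open import Data.Nat.Divisibility using (_∣_; _∤_)
open import Data.Product using (∃; ∃-syntax; Σ-syntax; _×_)
open import Data.Sign using (Sign; opposite) renaming (_*_ to _*ₛ_; + to plus)
open import Data.Vec using (lookup)
open import Function using (_⇔_; Equivalence)
open import Level using (0ℓ)
open import Relation.Binary using (Rel)
open import Relation.Binary.Construct.Closure.ReflexiveTransitive using (Star; ε; _◅_; gmap)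
open import Relation.Binary.PropositionalEquality using (_≡_; _≢_; cong; cong₂)
open import Relation.Nullary using (¬_)
open import Relation.Unary using (Pred; _∈_)

-- A finite simple graph; up to relabelling its vertex set is Fin n.

record Graph (n : ℕ) : Set where
  field
    adj : Fin n → Fin n → Bool

  Adj : Fin n → Fin n → Set
  Adj u v = T (adj u v)

  field
    symm   : ∀ u v → Adj u v → Adj v u
    irrefl : ∀ u → ¬ Adj u u

open Graph public

Walk : ∀ {n} → Graph n → Fin n → Fin n → Set
Walk G = Star (Adj G)

Connected : ∀ {n} → Graph n → Set
Connected G = ∀ u v → Walk G u v

Bipartite : ∀ {n} → Graph n → Set
Bipartite {n} G = Σ[ U ∈ Subset n ] (∀ u v → Adj G u v → lookup U u ≢ lookup U v)

module _ {V : Set} {E : Rel V 0ℓ} where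

  length : ∀ {u v} → Star E u v → ℕ
  length ε       = 0
  length (_ ◅ w) = suc (length w)

  -- All vertices visited except the last one, so that the base vertex of a
  -- closed walk is listed once.
  vertices : ∀ {u v} → Star E u v → List V
  vertices ε             = []
  vertices (_◅_ {u} _ w) = u ∷ vertices w

-- A cycle is represented by a closed walk traversing it once: this adds a choice
-- of base vertex and direction, on which neither length nor sign depends.

record Cycle {n} (G : Graph n) : Set where
  field
    {base}   : Fin n
    walk     : Walk G base base
    3≤length : 3 ≤ length walk
    distinct : Unique (vertices walk)

  OddCycle EvenCycle : Set
  OddCycle  = 2 ∤ length walk
  EvenCycle = 2 ∣ length walk

open Cycle public

record GraphIso {m n} (G : Graph m) (H : Graph n) : Set where
  field
    perm      : Permutation m n
    preserves : ∀ u v → Adj G u v ⇔ Adj H (perm ⟨$⟩ʳ u) (perm ⟨$⟩ʳ v)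

  onEdge : ∀ {u v} → Adj G u v → Adj H (perm ⟨$⟩ʳ u) (perm ⟨$⟩ʳ v)
  onEdge {u} {v} = Equivalence.to (preserves u v)

  onWalk : ∀ {u v} → Walk G u v → Walk H (perm ⟨$⟩ʳ u) (perm ⟨$⟩ʳ v)
  onWalk = gmap (perm ⟨$⟩ʳ_) onEdge

open GraphIso public

Aut : ∀ {n} → Graph n → Set
Aut G = GraphIso G G

-- A signature on the unordered edges of G. Since Adj is proof-irrelevant, the
-- symmetry field makes the sign depend only on the edge {u , v}.

record SignedGraph {n} (G : Graph n) : Set where
  field
    sign     : ∀ u v → Adj G u v → Sign
    signSymm : ∀ u v (e : Adj G u v) (e′ : Adj G v u) → sign u v e ≡ sign v u e′

open SignedGraph public

module _ {n} {G : Graph n} where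

  negate : SignedGraph G → SignedGraph G
  negate Γ .sign u v e        = opposite (sign Γ u v e)
  negate Γ .signSymm u v e e′ = cong opposite (signSymm Γ u v e e′)

  switch : Subset n → SignedGraph G → SignedGraph G
  switch U Γ .sign u v e =
    if lookup U u xor lookup U v then opposite (sign Γ u v e) else sign Γ u v e
  switch U Γ .signSymm u v e e′ =
    cong₂ (λ b s → if b then opposite s else s)
          (xor-comm (lookup U u) (lookup U v)) (signSymm Γ u v e e′)
    where open import Data.Bool.Properties using (xor-comm)

  walkSign : SignedGraph G → ∀ {u v} → Walk G u v → Sign
  walkSign Γ ε                 = plus
  walkSign Γ (_◅_ {u} {v} e w) = sign Γ u v e *ₛ walkSign Γ w

_≅_ : ∀ {m n} {G : Graph m} {H : Graph n} → SignedGraph G → SignedGraph H → Set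
_≅_ {G = G} {H} Γ Δ =
  Σ[ φ ∈ GraphIso G H ] (∀ u v (e : Adj G u v) →
    sign Δ (perm φ ⟨$⟩ʳ u) (perm φ ⟨$⟩ʳ v) (onEdge φ e) ≡ sign Γ u v e)

_≃_ : ∀ {m n} {G : Graph m} {H : Graph n} → SignedGraph G → SignedGraph H → Set
Γ ≃ Δ = ∃[ U ] (Γ ≅ switch U Δ)

SignSymmetric : ∀ {n} {G : Graph n} → SignedGraph G → Set
SignSymmetric Γ = Γ ≃ negate Γ

_^ₚ_ : ∀ {n} → Permutation′ n → ℕ → Permutation′ n
π ^ₚ zero  = id
π ^ₚ suc k = π ∘ₚ (π ^ₚ k)

HasOrder : ∀ {n} → Permutation′ n → ℕ → Set
HasOrder π k = 0 < k × (π ^ₚ k) ≈ id × (∀ j → 0 < j → (π ^ₚ j) ≈ id → k ≤ j)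

module _ {n} {G : Graph n} where

  WeakAutomorphism : SignedGraph G → Aut G → Set
  WeakAutomorphism Γ φ = (C : Cycle G) →
    (OddCycle C  → walkSign Γ (onWalk φ (walk C)) ≡ opposite (walkSign Γ (walk C))) ×
    (EvenCycle C → walkSign Γ (onWalk φ (walk C)) ≡ walkSign Γ (walk C))

  PrincipalOfOrder : SignedGraph G → ℕ → Aut G → Set
  PrincipalOfOrder Γ k φ =
    WeakAutomorphism Γ φ ×
    HasOrder (perm φ) k ×
    (∀ ψ l → WeakAutomorphism Γ ψ → HasOrder (perm ψ) l → k ≤ l)

𝕊 : ∀ {n} (G : Graph n) → Pred (SignedGraph G) 0ℓ
𝕊 G = SignSymmetric

𝕊[_] : ℕ → ∀ {n} (G : Graph n) → Pred (SignedGraph G) 0ℓ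
𝕊[ r ] G Γ = Γ ∈ 𝕊 G × ∃ (PrincipalOfOrder Γ (2 * r))

-- A switching isomorphism φ from Γ to −Γ multiplies the sign of each closed walk
-- by (−1)^length, since switching functions cancel around a closed walk; so φ is a
-- weak automorphism. Its k-th power multiplies the sign of an odd cycle by (−1)^k,
-- and an odd cycle exists as G is not bipartite, so φᵏ = id forces k to be even.
-- A least k for which some weak automorphism satisfies φᵏ = id is then a principal
-- order. Constructively, this least k exists because being a weak automorphism is
-- decidable: cycles have length at most n, and there are finitely many vertex maps.

module Submission where

open import Defs
open import Data.Bool using (Bool; true; false; if_then_else_)
open import Data.Bool.Properties using (T?; T-irrelevant)
open import Data.Fin as Fin using (Fin; zero; suc; funToFin; finToFun; toℕ)
open import Data.Fin.Permutation
  using (Permutation′; permutation; _⟨$⟩ʳ_; _⟨$⟩ˡ_; _≈_; inverseˡ; inverseʳ) renaming (id to idₚ)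
open import Data.Fin.Properties as Fin
  using (all?; any?; pigeonhole; injective⇒≤; finToFun-funToFin)
open import Data.Fin.Subset using (Subset)
open import Data.List as List using (List; []; _∷_; map)
open import Data.List.Membership.Propositional using (_∈_)
open import Data.List.Membership.Propositional.Properties using (∈-lookup)
open import Data.List.Relation.Unary.All as All using ([]; _∷_)
open import Data.List.Relation.Unary.All.Properties using (¬Any⇒All¬)
open import Data.List.Relation.Unary.AllPairs using ([]; _∷_)
open import Data.List.Relation.Unary.Any using (here; there)
open import Data.List.Relation.Unary.Unique.Propositional using (Unique)
open import Data.List.Relation.Unary.Unique.Propositional.Properties using (map⁺)
open import Data.Nat
  using (ℕ; zero; suc; _+_; _*_; _^_; _∸_; _≤_; _<_; z≤n; s≤s; z<s; _≤?_; _<?_)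
open import Data.Nat.Divisibility using (_∣_; _∤_; divides; _∣?_; _∣0; ∣-refl; ∣m∣n⇒∣m+n)
open import Data.Nat.Induction using (Acc; acc; <-wellFounded)
open import Data.Nat.Properties as ℕ
  using (≮⇒≥; allUpTo?; anyUpTo?; m<n⇒0<n∸m; m+[n∸m]≡n; <⇒≤; n<1+n; m<m+n; m<n+m; *-comm)
open import Data.Product using (∃; ∃-syntax; Σ-syntax; _×_; _,_; proj₁; proj₂)
open import Data.Sign using (Sign; opposite) renaming (_*_ to _*ₛ_; + to plus; - to minus)
open import Data.Sign.Properties as Sign
  using (s*s≡+; s≢opposite[s]; *-assoc; opposite-involutive)
open import Data.Sum using (_⊎_; inj₁; inj₂)
open import Data.Vec as Vec using (lookup; tabulate)
open import Data.Vec.Properties using (lookup∘tabulate)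
open import Algebra.Properties.CommutativeSemigroup Sign.*-commutativeSemigroup
  using (interchange; x∙yz≈y∙xz)
open import Function using (Equivalence; mk⇔; _∘_; Injection)
open import Function.Construct.Composition using (_⇔-∘_)
open import Function.Construct.Identity using (⇔-id)
open import Function.Properties.Inverse using (↔⇒↣)
open import Level using (0ℓ)
open import Relation.Binary using (Rel)
open import Relation.Binary.Construct.Closure.ReflexiveTransitive
  using (Star; ε; _◅_; _◅◅_; gmap)
open import Relation.Binary.Construct.Closure.ReflexiveTransitive.Properties
  using (gmap-id; gmap-∘)
open import Relation.Binary.PropositionalEquality
  using (_≡_; _≢_; refl; sym; trans; cong; cong₂; subst; subst₂; module ≡-Reasoning)
open import Relation.Nullary using (¬_; Dec; yes; no; contradiction)
open import Relation.Nullary.Decidable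
  using (map′; decidable-stable; _×-dec_; _→-dec_)
open import Relation.Unary using (_≐_; ⋃; Decidable)

-- Least witnesses, signs of parities, and lists without repetition.

module _ {P : ℕ → Set} (P? : Decidable P) where

  -- Bounded search below a known witness either finds a smaller one, from which to restart, or
  -- certifies that the current one is minimal.
  least : ∀ k → P k → ∃[ m ] P m × (∀ j → P j → m ≤ j)
  least k = go (<-wellFounded k)
    where
    go : ∀ {k} → Acc _<_ k → P k → ∃[ m ] P m × (∀ j → P j → m ≤ j)
    go {k} (acc rs) pk with anyUpTo? P? k
    ... | yes (j , j<k , pj) = go (rs j<k) pj
    ... | no  none           = k , pk , λ j pj → ≮⇒≥ λ j<k → none (j , j<k , pj)

sgn : ℕ → Sign
sgn zero    = plus
sgn (suc k) = opposite (sgn k)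

opposite-* : ∀ s t → opposite s *ₛ t ≡ opposite (s *ₛ t)
opposite-* plus  t = refl
opposite-* minus t = sym (opposite-involutive t)

sgn-+ : ∀ m n → sgn (m + n) ≡ sgn m *ₛ sgn n
sgn-+ zero    n = refl
sgn-+ (suc m) n = trans (cong opposite (sgn-+ m n)) (sym (opposite-* (sgn m) (sgn n)))

sgn-even : ∀ {k} → 2 ∣ k → sgn k ≡ plus
sgn-even (divides q refl) = go q
  where
  go : ∀ q → sgn (q * 2) ≡ plus
  go zero    = refl
  go (suc q) = trans (opposite-involutive _) (go q)

sgn-odd : ∀ {k} → 2 ∤ k → sgn k ≡ minus
sgn-odd {zero}        2∤0   = contradiction (2 ∣0) 2∤0
sgn-odd {suc zero}    _     = refl
sgn-odd {suc (suc k)} 2∤2+k =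
  trans (opposite-involutive _) (sgn-odd {k} λ 2∣k → 2∤2+k (∣m∣n⇒∣m+n ∣-refl 2∣k))

Unique⇒lookup-injective : ∀ {A : Set} {xs : List A} → Unique xs →
                          ∀ {i j} → List.lookup xs i ≡ List.lookup xs j → i ≡ j
Unique⇒lookup-injective (x∉ ∷ _)  {zero}  {zero}  _  = refl
Unique⇒lookup-injective (x∉ ∷ _)  {zero}  {suc j} eq = contradiction eq (All.lookup x∉ (∈-lookup j))
Unique⇒lookup-injective (x∉ ∷ _)  {suc i} {zero}  eq = contradiction (sym eq) (All.lookup x∉ (∈-lookup i))
Unique⇒lookup-injective (_ ∷ xs!) {suc i} {suc j} eq = cong suc (Unique⇒lookup-injective xs! eq)

Unique⇒length≤ : ∀ {n} {xs : List (Fin n)} → Unique xs → List.length xs ≤ n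
Unique⇒length≤ xs! = injective⇒≤ (Unique⇒lookup-injective xs!)

-- Powers of permutations.

module _ {n : ℕ} where

  open import Data.List.Membership.DecPropositional (Fin._≟_ {n}) public using (_∈?_)
  open import Data.List.Relation.Unary.Unique.DecPropositional (Fin._≟_ {n}) public using (unique?)

  ⟨$⟩ʳ-injective : (π : Permutation′ n) → ∀ {i j} → π ⟨$⟩ʳ i ≡ π ⟨$⟩ʳ j → i ≡ j
  ⟨$⟩ʳ-injective π = Injection.injective (↔⇒↣ π)

  ^ₚ-cong : ∀ {π ρ : Permutation′ n} k → π ≈ ρ → (π ^ₚ k) ≈ (ρ ^ₚ k)
  ^ₚ-cong         zero    π≈ρ i = refl
  ^ₚ-cong {π} {ρ} (suc k) π≈ρ i = trans (^ₚ-cong k π≈ρ _) (cong ((ρ ^ₚ k) ⟨$⟩ʳ_) (π≈ρ i))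

  ^ₚ-+ : ∀ (π : Permutation′ n) j k i → (π ^ₚ (j + k)) ⟨$⟩ʳ i ≡ (π ^ₚ k) ⟨$⟩ʳ ((π ^ₚ j) ⟨$⟩ʳ i)
  ^ₚ-+ π zero    k i = refl
  ^ₚ-+ π (suc j) k i = ^ₚ-+ π j k (π ⟨$⟩ʳ i)

  ^ₚ-comm : ∀ (π : Permutation′ n) j k i →
            (π ^ₚ k) ⟨$⟩ʳ ((π ^ₚ j) ⟨$⟩ʳ i) ≡ (π ^ₚ j) ⟨$⟩ʳ ((π ^ₚ k) ⟨$⟩ʳ i)
  ^ₚ-comm π j k i =
    trans (sym (^ₚ-+ π j k i)) (trans (cong (λ m → (π ^ₚ m) ⟨$⟩ʳ i) (ℕ.+-comm j k)) (^ₚ-+ π k j i))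

  -- There are `n ^ n` codes for self-maps of `Fin n`, so two of the powers with exponents 0 to
  -- `n ^ n` coincide. Cancelling the lower power leaves the difference of the exponents as a
  -- period.
  finiteOrder : ∀ (π : Permutation′ n) → ∃[ k ] 0 < k × (π ^ₚ k) ≈ idₚ
  finiteOrder π with pigeonhole (n<1+n (n ^ n)) (λ i → funToFin ((π ^ₚ toℕ i) ⟨$⟩ʳ_))
  ... | i , j , i<j , same = d , m<n⇒0<n∸m i<j , λ x →
      ⟨$⟩ʳ-injective (π ^ₚ toℕ i) (begin
        (π ^ₚ toℕ i) ⟨$⟩ʳ ((π ^ₚ d) ⟨$⟩ʳ x)       ≡⟨ ^ₚ-comm π d (toℕ i) x ⟩
        (π ^ₚ d) ⟨$⟩ʳ ((π ^ₚ toℕ i) ⟨$⟩ʳ x)       ≡⟨ ^ₚ-+ π (toℕ i) d x ⟨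
        (π ^ₚ (toℕ i + d)) ⟨$⟩ʳ x                 ≡⟨ cong (λ m → (π ^ₚ m) ⟨$⟩ʳ x) (m+[n∸m]≡n (<⇒≤ i<j)) ⟩
        (π ^ₚ toℕ j) ⟨$⟩ʳ x                       ≡⟨ finToFun-funToFin ((π ^ₚ toℕ j) ⟨$⟩ʳ_) x ⟨
        finToFun (funToFin ((π ^ₚ toℕ j) ⟨$⟩ʳ_)) x ≡⟨ cong (λ c → finToFun c x) same ⟨
        finToFun (funToFin ((π ^ₚ toℕ i) ⟨$⟩ʳ_)) x ≡⟨ finToFun-funToFin ((π ^ₚ toℕ i) ⟨$⟩ʳ_) x ⟩
        (π ^ₚ toℕ i) ⟨$⟩ʳ x                       ∎)
    where
    open ≡-Reasoning
    d = toℕ j ∸ toℕ i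

-- Lengths, vertices and splittings of walks.

module _ {V : Set} {E : Rel V 0ℓ} where

  length-◅◅ : ∀ {u v w} (p : Star E u v) (q : Star E v w) → length (p ◅◅ q) ≡ length p + length q
  length-◅◅ ε       q = refl
  length-◅◅ (_ ◅ p) q = cong suc (length-◅◅ p q)

  length-vertices : ∀ {u v} (w : Star E u v) → List.length (vertices w) ≡ length w
  length-vertices ε       = refl
  length-vertices (_ ◅ w) = cong suc (length-vertices w)

  length-gmap : ∀ (f : V → V) (g : ∀ {u v} → E u v → E (f u) (f v)) {u v} (w : Star E u v) →
                length (gmap {U = E} f g w) ≡ length w
  length-gmap f g ε       = refl
  length-gmap f g (_ ◅ w) = cong suc (length-gmap f g w)

  vertices-gmap : ∀ (f : V → V) (g : ∀ {u v} → E u v → E (f u) (f v)) {u v} (w : Star E u v) →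
                  vertices (gmap {U = E} f g w) ≡ map f (vertices w)
  vertices-gmap f g ε       = refl
  vertices-gmap f g (_ ◅ w) = cong (_ ∷_) (vertices-gmap f g w)

  -- The second piece is never empty because `vertices` omits the final vertex: every listed
  -- occurrence is followed by an edge.
  splitAt-∈ : ∀ {u v x} (w : Star E u v) → x ∈ vertices w →
              Σ[ p ∈ Star E u x ] Σ[ q ∈ Star E x v ] 0 < length q × length w ≡ length p + length q
  splitAt-∈ (e ◅ w) (here refl) = ε , e ◅ w , z<s , refl
  splitAt-∈ (e ◅ w) (there x∈) with splitAt-∈ w x∈
  ... | p , q , 0<q , eq = e ◅ p , q , 0<q , cong suc eq

-- Graphs without odd cycles are bipartite.

module _ {n : ℕ} (G : Graph n) where

  -- Only the lengths of the pieces are recorded, since only parity will matter. Both pieces are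
  -- nonempty, so each is strictly shorter than `w`, and for a closed `w` both are closed.
  Detour : ∀ {u v} → Walk G u v → Set
  Detour {u} {v} w = ∃[ x ] Σ[ loop ∈ Walk G x x ] Σ[ rest ∈ Walk G u v ]
    0 < length loop × 0 < length rest × length w ≡ length loop + length rest

  -- If the first vertex recurs, the walk up to its recurrence is the loop. Otherwise a loop found
  -- in the tail is kept, and the first edge is put in front of what remains.
  unique⊎detour : ∀ {u v} (w : Walk G u v) → Unique (vertices w) ⊎ Detour w
  unique⊎detour ε = inj₁ []
  unique⊎detour {u} (e ◅ w) with u ∈? vertices w | unique⊎detour w
  ... | yes u∈ | _ with splitAt-∈ w u∈
  ...   | p , q , 0<q , eq = inj₂ (u , e ◅ p , q , z<s , 0<q , cong suc eq)
  unique⊎detour {u} (e ◅ w) | no u∉ | inj₁ w! = inj₁ (¬Any⇒All¬ _ u∉ ∷ w!)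
  unique⊎detour {u} (e ◅ w) | no u∉ | inj₂ (x , loop , rest , 0<l , 0<r , eq) =
    inj₂ (x , loop , e ◅ rest , 0<l , z<s , trans (cong suc eq) (sym (ℕ.+-suc _ _)))

  module _ (noOdd : (C : Cycle G) → ¬ OddCycle C) where

    -- Strong induction on length: a detour cuts the walk into two shorter closed walks, whose
    -- parities multiply as signs.
    sgn-closedWalk : ∀ {u} (w : Walk G u u) → sgn (length w) ≡ plus
    sgn-closedWalk w = go w (<-wellFounded _)
      where
      go : ∀ {u} (w : Walk G u u) → Acc _<_ (length w) → sgn (length w) ≡ plus
      go w (acc rs) with unique⊎detour w
      ... | inj₂ (x , loop , rest , 0<l , 0<r , eq) = begin
          sgn (length w)                        ≡⟨ cong sgn eq ⟩
          sgn (length loop + length rest)       ≡⟨ sgn-+ (length loop) _ ⟩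
          sgn (length loop) *ₛ sgn (length rest)
            ≡⟨ cong₂ _*ₛ_ (go loop (rs (subst (_ <_) (sym eq) (m<m+n _ 0<r))))
                          (go rest (rs (subst (_ <_) (sym eq) (m<n+m _ 0<l)))) ⟩
          plus                                  ∎
        where open ≡-Reasoning
      -- Closed walks without repetition that are too short to be cycles: length 1 would be a loop
      -- of the graph, and lengths 0 and 2 are even. From length 3 on the walk is a cycle, whose
      -- length `noOdd` forces to be even.
      go ε               (acc rs) | inj₁ _ = refl
      go (e ◅ ε)         (acc rs) | inj₁ _ = contradiction e (irrefl G _)
      go (_ ◅ _ ◅ ε)     (acc rs) | inj₁ _ = refl
      go w@(_ ◅ _ ◅ _ ◅ _) (acc rs) | inj₁ w! =
        sgn-even (decidable-stable (2 ∣? length w)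
          (noOdd (record { walk = w ; 3≤length = s≤s (s≤s (s≤s z≤n)) ; distinct = w! })))

  positive : Sign → Bool
  positive plus  = true
  positive minus = false

  positive-injective : ∀ {s t} → positive s ≡ positive t → s ≡ t
  positive-injective {plus}  {plus}  _ = refl
  positive-injective {minus} {minus} _ = refl

  -- Vertices are coloured by the parity of a chosen walk from a root; any choice will do, since all
  -- closed walks are even.
  noOddCycle⇒bipartite : Connected G → (∀ C → ¬ OddCycle {G = G} C) → Bipartite G
  noOddCycle⇒bipartite conn noOdd = go n refl
    where
    module _ (root : Fin n) where

      colour : Fin n → Sign
      colour v = sgn (length (conn root v))

      U : Subset n
      U = tabulate (positive ∘ colour)

      colour-step : ∀ u v → Adj G u v → colour u ≡ opposite (colour v)
      -- The closed walks from the root through `u`, `e` and `back`, and from the root through `v`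
      -- and `back`, share their return to the root. Both being even, the two outward walks differ
      -- in parity.
      colour-step u v e = sides (colour u) (colour v) (sgn (length back)) via-u via-v
        where
        back = conn v root
        via-u : colour u *ₛ opposite (sgn (length back)) ≡ plus
        via-u = trans (sym (sgn-+ (length (conn root u)) (suc (length back))))
          (trans (cong sgn (sym (length-◅◅ (conn root u) (e ◅ back))))
                 (sgn-closedWalk noOdd (conn root u ◅◅ e ◅ back)))
        via-v : colour v *ₛ sgn (length back) ≡ plus
        via-v = trans (sym (sgn-+ (length (conn root v)) (length back)))
          (trans (cong sgn (sym (length-◅◅ (conn root v) back)))
                 (sgn-closedWalk noOdd (conn root v ◅◅ back)))
        sides : ∀ s t r → s *ₛ opposite r ≡ plus → t *ₛ r ≡ plus → s ≡ opposite t
        sides plus  minus minus _ _ = refl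
        sides minus plus  plus  _ _ = refl

      U-bipartition : ∀ u v → Adj G u v → lookup U u ≢ lookup U v
      U-bipartition u v e same = s≢opposite[s] (colour v) (trans
        (sym (positive-injective (trans (sym (lookup∘tabulate _ u)) (trans same (lookup∘tabulate _ v)))))
        (colour-step u v e))

    go : ∀ m → n ≡ m → Bipartite G
    -- The empty graph offers no root, but its empty vertex set is trivially bipartitioned.
    go zero    refl = Vec.[] , λ ()
    go (suc _) refl = U zero , U-bipartition zero

  -- Deciding properties of all cycles and searching the automorphisms.

  allWalks? : ∀ k u v {P : Walk G u v → Set} → Decidable P → Dec (∀ w → length w ≡ k → P w)
  allWalks? zero u v P? with u Fin.≟ v
  ... | yes refl = map′ (λ { p ε refl → p }) (λ f → f ε refl) (P? ε)
  ... | no  u≢v  = yes λ { ε _ → contradiction refl u≢v }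
  allWalks? (suc k) u v {P} P? =
    map′ (λ { f (_◅_ {j = x} e w) refl → f x e w refl }) (λ f x e w eq → f (e ◅ w) (cong suc eq))
         (all? viaNeighbour?)
    where
    viaNeighbour? : ∀ x → Dec ((e : Adj G u x) → ∀ w → length w ≡ k → P (e ◅ w))
    viaNeighbour? x with T? (adj G u x)
    ... | no  ¬e = yes λ e → contradiction e ¬e
    -- Adjacency is proof-irrelevant, so testing a single edge proof covers them all.
    ... | yes e  = map′ (λ f e′ w eq → subst (λ e → P (e ◅ w)) (T-irrelevant e e′) (f w eq)) (λ f → f e)
                        (allWalks? k x v (λ w → P? (e ◅ w)))

  -- The vertices of a cycle are distinct, so its length is at most `n` and finitely many walk
  -- lengths suffice.
  allCycles? : {P : ∀ {u} → Walk G u u → Set} → (∀ {u} → Decidable (P {u})) →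
               Dec (∀ (C : Cycle G) → P (walk C))
  allCycles? {P} P? = map′ onCycles onWalks
    (all? λ u → allUpTo? (λ k → allWalks? k u u (λ w →
      3 ≤? length w →-dec unique? (vertices w) →-dec P? w)) (suc n))
    where
    onCycles : (∀ u {k} → k < suc n → (w : Walk G u u) → length w ≡ k →
                3 ≤ length w → Unique (vertices w) → P w) → ∀ C → P (walk C)
    onCycles f C = f (base C)
      (s≤s (subst (_≤ n) (length-vertices (walk C)) (Unique⇒length≤ (distinct C))))
      (walk C) refl (3≤length C) (distinct C)
    onWalks : (∀ C → P (walk C)) → ∀ u {k} → k < suc n → (w : Walk G u u) → length w ≡ k →
              3 ≤ length w → Unique (vertices w) → P w
    onWalks f u _ w _ 3≤ w! = f (record { walk = w ; 3≤length = 3≤ ; distinct = w! })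

  module _ {P : Aut G → Set} (P-resp : ∀ φ ψ → perm φ ≈ perm ψ → P φ → P ψ)
           (P? : Decidable P) where

    -- The inverse is carried as data, so bijectivity becomes two families of decidable equations.
    IsAut : (f g : Fin n → Fin n) → Set
    IsAut f g = (∀ x → f (g x) ≡ x) × (∀ x → g (f x) ≡ x) ×
                (∀ u v → (Adj G u v → Adj G (f u) (f v)) × (Adj G (f u) (f v) → Adj G u v))

    toAut : ∀ {f g} → IsAut f g → Aut G
    toAut (fg , gf , pres) = record
      { perm      = permutation _ _ fg gf
      ; preserves = λ u v → mk⇔ (proj₁ (pres u v)) (proj₂ (pres u v))
      }

    isAut? : ∀ f g → Dec (IsAut f g)
    isAut? f g = all? (λ x → f (g x) Fin.≟ x) ×-dec all? (λ x → g (f x) Fin.≟ x) ×-dec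
      all? λ u → all? λ v → (T? (adj G u v) →-dec T? (adj G (f u) (f v))) ×-dec
                            (T? (adj G (f u) (f v)) →-dec T? (adj G u v))

    autWith? : ∀ f g → Dec (Σ[ a ∈ IsAut f g ] P (toAut a))
    autWith? f g with isAut? f g
    ... | no  ¬a = no (¬a ∘ proj₁)
    ... | yes a  = map′ (a ,_) (λ { (b , p) → P-resp (toAut b) (toAut a) (λ _ → refl) p }) (P? (toAut a))

    -- The search runs over codes of pairs of maps. Decoding recovers a map only up to pointwise
    -- equality, which is why `P` must respect it.
    anyAut? : Dec (∃ P)
    anyAut? = map′ (λ { (_ , _ , a , p) → toAut a , p }) encode
                   (any? λ i → any? λ j → autWith? (finToFun i) (finToFun j))
      where
      encode : ∃ P → ∃[ i ] ∃[ j ] Σ[ a ∈ IsAut (finToFun i) (finToFun j) ] P (toAut a)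
      encode (φ , p) = funToFin f , funToFin g , a , P-resp φ (toAut a) (λ x → sym (f≗ x)) p
        where
        f = perm φ ⟨$⟩ʳ_
        g = perm φ ⟨$⟩ˡ_
        f≗ = finToFun-funToFin f
        g≗ = finToFun-funToFin g
        a : IsAut (finToFun (funToFin f)) (finToFun (funToFin g))
        a = (λ x → trans (f≗ _) (trans (cong f (g≗ x)) (inverseʳ (perm φ))))
          , (λ x → trans (g≗ _) (trans (cong g (f≗ x)) (inverseˡ (perm φ))))
          , λ u v → subst₂ (Adj G) (sym (f≗ u)) (sym (f≗ v)) ∘ Equivalence.to (preserves φ u v)
                  , Equivalence.from (preserves φ u v) ∘ subst₂ (Adj G) (f≗ u) (f≗ v)

-- Signs of walks under automorphisms, negation and switching.

_^ₐ_ : ∀ {n} {G : Graph n} → Aut G → ℕ → Aut G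
-- Giving the permutation uniformly in `k` lets statements about `perm φ ^ₚ k` apply to `φ ^ₐ k` by
-- computation.
perm      (φ ^ₐ k)         = perm φ ^ₚ k
preserves (φ ^ₐ zero)  u v = ⇔-id _
preserves (φ ^ₐ suc k) u v = preserves (φ ^ₐ k) _ _ ⇔-∘ preserves φ u v

module _ {n : ℕ} {G : Graph n} where

  image : Aut G → Cycle G → Cycle G
  image φ C = record
    { walk     = onWalk φ (walk C)
    ; 3≤length = subst (3 ≤_) (sym (length-gmap _ (onEdge φ) (walk C))) (3≤length C)
    ; distinct = subst Unique (sym (vertices-gmap _ (onEdge φ) (walk C)))
                       (map⁺ (⟨$⟩ʳ-injective (perm φ)) (distinct C))
    }

  -- The switching function of `U`, with values in the signs: switching multiplies each edge by its
  -- values at both ends.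
  side : Subset n → Fin n → Sign
  side U v = if lookup U v then minus else plus

  walkSign-≅ : ∀ {Γ Δ : SignedGraph G} ((φ , _) : Γ ≅ Δ) {u v} (w : Walk G u v) →
               walkSign Δ (onWalk φ w) ≡ walkSign Γ w
  walkSign-≅ iso            ε       = refl
  walkSign-≅ iso@(φ , same) (e ◅ w) = cong₂ _*ₛ_ (same _ _ e) (walkSign-≅ iso w)

  module _ (Γ : SignedGraph G) where

    sign-cong : ∀ {u u′ v v′} → u ≡ u′ → v ≡ v′ → (e : Adj G u v) (e′ : Adj G u′ v′) →
                sign Γ u v e ≡ sign Γ u′ v′ e′
    sign-cong refl refl e e′ = cong (sign Γ _ _) (T-irrelevant e e′)

    walkSign-onWalk-cong : ∀ (φ ψ : Aut G) → perm φ ≈ perm ψ → ∀ {u v} (w : Walk G u v) →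
                           walkSign Γ (onWalk φ w) ≡ walkSign Γ (onWalk ψ w)
    walkSign-onWalk-cong φ ψ φ≈ψ ε = refl
    walkSign-onWalk-cong φ ψ φ≈ψ (e ◅ w) =
      cong₂ _*ₛ_ (sign-cong (φ≈ψ _) (φ≈ψ _) _ _) (walkSign-onWalk-cong φ ψ φ≈ψ w)

    walkSign-negate : ∀ {u v} (w : Walk G u v) → walkSign (negate Γ) w ≡ sgn (length w) *ₛ walkSign Γ w
    walkSign-negate ε = refl
    walkSign-negate (e ◅ w) =
      trans (cong (opposite (sign Γ _ _ e) *ₛ_) (walkSign-negate w))
            (swap (sign Γ _ _ e) (sgn (length w)) (walkSign Γ w))
      where
      swap : ∀ s t r → opposite s *ₛ (t *ₛ r) ≡ opposite t *ₛ (s *ₛ r)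
      swap plus  plus  r = refl
      swap plus  minus r = opposite-involutive r
      swap minus plus  r = sym (opposite-involutive r)
      swap minus minus r = refl

    sign-switch : ∀ U u v e → sign (switch U Γ) u v e ≡ (side U u *ₛ side U v) *ₛ sign Γ u v e
    sign-switch U u v e with lookup U u | lookup U v
    ... | true  | true  = refl
    ... | true  | false = refl
    ... | false | true  = refl
    ... | false | false = refl

    -- Each inner visit to a vertex contributes its `side` twice and cancels, leaving the two ends.
    -- On a closed walk these cancel as well.
    walkSign-switch : ∀ U {u v} (w : Walk G u v) →
                      walkSign (switch U Γ) w ≡ (side U u *ₛ side U v) *ₛ walkSign Γ w
    walkSign-switch U {u} ε = sym (trans (Sign.*-identityʳ _) (s*s≡+ (side U u)))
    walkSign-switch U {u} {v} (_◅_ {j = x} e w) =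
      trans (cong₂ _*ₛ_ (sign-switch U u x e) (walkSign-switch U w))
            (telescope (side U u) (side U x) (side U v) (sign Γ u x e) (walkSign Γ w))
      where
      telescope : ∀ a b c s r → ((a *ₛ b) *ₛ s) *ₛ ((b *ₛ c) *ₛ r) ≡ (a *ₛ c) *ₛ (s *ₛ r)
      telescope a b c s r = begin
        ((a *ₛ b) *ₛ s) *ₛ ((b *ₛ c) *ₛ r)  ≡⟨ cong (((a *ₛ b) *ₛ s) *ₛ_) (*-assoc b c r) ⟩
        ((a *ₛ b) *ₛ s) *ₛ (b *ₛ (c *ₛ r))  ≡⟨ interchange (a *ₛ b) s b (c *ₛ r) ⟩
        ((a *ₛ b) *ₛ b) *ₛ (s *ₛ (c *ₛ r))
          ≡⟨ cong (_*ₛ (s *ₛ (c *ₛ r))) (trans (*-assoc a b b) (trans (cong (a *ₛ_) (s*s≡+ b)) (Sign.*-identityʳ a))) ⟩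
        a *ₛ (s *ₛ (c *ₛ r))                ≡⟨ cong (a *ₛ_) (x∙yz≈y∙xz s c r) ⟩
        a *ₛ (c *ₛ (s *ₛ r))                ≡⟨ *-assoc a c (s *ₛ r) ⟨
        (a *ₛ c) *ₛ (s *ₛ r)                ∎
        where open ≡-Reasoning

  -- Weak automorphisms and their orders.

  module _ (Γ : SignedGraph G) where

    -- On cycles, this single equation of signs replaces the odd and even clauses of a weak
    -- automorphism, and it is decidable.
    Twists : Aut G → ∀ {u} → Walk G u u → Set
    Twists φ w = walkSign Γ (onWalk φ w) ≡ sgn (length w) *ₛ walkSign Γ w

    twists⇒weak : ∀ φ → (∀ C → Twists φ (walk C)) → WeakAutomorphism Γ φ
    twists⇒weak φ tw C =
      (λ odd  → trans (tw C) (cong (_*ₛ walkSign Γ (walk C)) (sgn-odd odd))) ,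
      (λ even → trans (tw C) (cong (_*ₛ walkSign Γ (walk C)) (sgn-even even)))

    weak⇒twists : ∀ φ → WeakAutomorphism Γ φ → ∀ C → Twists φ (walk C)
    weak⇒twists φ weak C with 2 ∣? length (walk C)
    ... | yes even = trans (proj₂ (weak C) even) (cong (_*ₛ walkSign Γ (walk C)) (sym (sgn-even even)))
    ... | no  odd  = trans (proj₁ (weak C) odd) (cong (_*ₛ walkSign Γ (walk C)) (sym (sgn-odd odd)))

    weak? : Decidable (WeakAutomorphism Γ)
    weak? φ = map′ (twists⇒weak φ) (weak⇒twists φ)
      (allCycles? G {Twists φ} λ w → walkSign Γ (onWalk φ w) Sign.≟ sgn (length w) *ₛ walkSign Γ w)

    weak-resp : ∀ φ ψ → perm φ ≈ perm ψ → WeakAutomorphism Γ φ → WeakAutomorphism Γ ψ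
    weak-resp φ ψ φ≈ψ weak C =
      (λ odd  → trans (walkSign-onWalk-cong Γ ψ φ (sym ∘ φ≈ψ) (walk C)) (proj₁ (weak C) odd)) ,
      (λ even → trans (walkSign-onWalk-cong Γ ψ φ (sym ∘ φ≈ψ) (walk C)) (proj₂ (weak C) even))

    signSymmetric⇒weak : SignSymmetric Γ → ∃ (WeakAutomorphism Γ)
    signSymmetric⇒weak (U , iso@(φ , _)) = φ , twists⇒weak φ λ C →
      let w  = walk C
          w′ = onWalk φ w
          s  = sgn (length w)
      in begin
        -- The sign `s` is inserted twice: one copy is absorbed in passing from `Γ` to `negate Γ`,
        -- the other survives as the required factor.
        walkSign Γ w′                              ≡⟨ cong (_*ₛ walkSign Γ w′) (s*s≡+ s) ⟨
        (s *ₛ s) *ₛ walkSign Γ w′                  ≡⟨ *-assoc s s _ ⟩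
        s *ₛ (s *ₛ walkSign Γ w′)                  ≡⟨ cong (λ l → s *ₛ (sgn l *ₛ walkSign Γ w′)) (length-gmap _ (onEdge φ) w) ⟨
        s *ₛ (sgn (length w′) *ₛ walkSign Γ w′)    ≡⟨ cong (s *ₛ_) (walkSign-negate Γ w′) ⟨
        s *ₛ walkSign (negate Γ) w′                ≡⟨ cong (λ t → s *ₛ (t *ₛ walkSign (negate Γ) w′)) (s*s≡+ (side U _)) ⟨
        s *ₛ ((side U _ *ₛ side U _) *ₛ walkSign (negate Γ) w′)
                                                   ≡⟨ cong (s *ₛ_) (walkSign-switch (negate Γ) U w′) ⟨
        s *ₛ walkSign (switch U (negate Γ)) w′     ≡⟨ cong (s *ₛ_) (walkSign-≅ iso w) ⟩
        s *ₛ walkSign Γ w                          ∎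
      where open ≡-Reasoning

    -- The image of an odd cycle is again an odd cycle, so the induction continues at `image φ C`,
    -- and every application contributes one factor `minus`.
    weak-power : ∀ φ → WeakAutomorphism Γ φ → ∀ k C → OddCycle {G = G} C →
                 walkSign Γ (onWalk (φ ^ₐ k) (walk C)) ≡ sgn k *ₛ walkSign Γ (walk C)
    weak-power φ weak zero    C odd = cong (walkSign Γ) (gmap-id (walk C))
    weak-power φ weak (suc k) C odd = begin
      walkSign Γ (onWalk (φ ^ₐ suc k) (walk C))
        ≡⟨ cong (walkSign Γ) (gmap-∘ _ (onEdge (φ ^ₐ k)) _ (onEdge φ) (walk C)) ⟨
      walkSign Γ (onWalk (φ ^ₐ k) (onWalk φ (walk C)))
        ≡⟨ weak-power φ weak k (image φ C) (subst (2 ∤_) (sym (length-gmap _ (onEdge φ) (walk C))) odd) ⟩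
      sgn k *ₛ walkSign Γ (onWalk φ (walk C))
        ≡⟨ cong (sgn k *ₛ_) (proj₁ (weak C) odd) ⟩
      sgn k *ₛ (minus *ₛ walkSign Γ (walk C))
        ≡⟨ *-assoc (sgn k) minus _ ⟨
      (sgn k *ₛ minus) *ₛ walkSign Γ (walk C)
        ≡⟨ cong (_*ₛ walkSign Γ (walk C)) (Sign.*-comm (sgn k) minus) ⟩
      sgn (suc k) *ₛ walkSign Γ (walk C) ∎
      where open ≡-Reasoning

    -- No odd cycle has to be exhibited: evenness is decidable, and if `k` were odd, each odd cycle
    -- would have a sign equal to its opposite, so the graph would be bipartite.
    weak-evenOrder : Connected G → ¬ Bipartite G → ∀ φ → WeakAutomorphism Γ φ →
                     ∀ k → (perm φ ^ₚ k) ≈ idₚ → 2 ∣ k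
    weak-evenOrder conn ¬bip φ weak k φᵏ≈id = decidable-stable (2 ∣? k) λ 2∤k →
      ¬bip (noOddCycle⇒bipartite G conn λ C odd → s≢opposite[s] (walkSign Γ (walk C)) (begin
        walkSign Γ (walk C)                    ≡⟨ weak-power φ weak 0 C odd ⟨
        -- The powers 0 and `k` agree only pointwise, so their image walks have different types and
        -- are compared through their signs.
        walkSign Γ (onWalk (φ ^ₐ 0) (walk C))  ≡⟨ walkSign-onWalk-cong Γ (φ ^ₐ 0) (φ ^ₐ k) (sym ∘ φᵏ≈id) (walk C) ⟩
        walkSign Γ (onWalk (φ ^ₐ k) (walk C))  ≡⟨ weak-power φ weak k C odd ⟩
        sgn k *ₛ walkSign Γ (walk C)           ≡⟨ cong (_*ₛ walkSign Γ (walk C)) (sgn-odd 2∤k) ⟩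
        opposite (walkSign Γ (walk C))         ∎))
      where open ≡-Reasoning

    HasPeriod : ℕ → Aut G → Set
    HasPeriod k φ = WeakAutomorphism Γ φ × (perm φ ^ₚ k) ≈ idₚ

    period? : ∀ k → Dec (0 < k × ∃ (HasPeriod k))
    period? k = 0 <? k ×-dec anyAut? G resp
      (λ φ → weak? φ ×-dec all? λ i → ((perm φ ^ₚ k) ⟨$⟩ʳ i) Fin.≟ i)
      where
      resp : ∀ φ ψ → perm φ ≈ perm ψ → HasPeriod k φ → HasPeriod k ψ
      resp φ ψ φ≈ψ (weak , φᵏ≈id) = weak-resp φ ψ φ≈ψ weak ,
        λ i → trans (sym (^ₚ-cong {π = perm φ} {ρ = perm ψ} k φ≈ψ i)) (φᵏ≈id i)

    -- The least positive period `m` over all weak automorphisms is attained by some `ψ`. Minimality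
    -- against the periods of `ψ` itself makes `m` its exact order; minimality against all others
    -- makes `ψ` principal.
    weak⇒principal : ∃ (WeakAutomorphism Γ) → ∃[ k ] ∃ (PrincipalOfOrder Γ k)
    weak⇒principal (φ , weak) with finiteOrder (perm φ)
    ... | k , 0<k , φᵏ≈id with least period? k (0<k , φ , weak , φᵏ≈id)
    ...   | m , (0<m , ψ , weakψ , ψᵐ≈id) , minimal = m , ψ , weakψ ,
        (0<m , ψᵐ≈id , λ j 0<j ψʲ≈id → minimal j (0<j , ψ , weakψ , ψʲ≈id)) ,
        λ { χ l weakχ (0<l , χˡ≈id , _) → minimal l (0<l , χ , weakχ , χˡ≈id) }

proposition3p1 : ∀ (n : ℕ) (G : Graph n) → Connected G → ¬ Bipartite G →
    𝕊 G ≐ (⋃[ r ∶ ℕ ] 𝕊[ suc r ] G)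
proposition3p1 n G conn ¬bip = (λ {Γ} → ⊆-union {Γ}) , λ { (_ , symmetric , _) → symmetric }
  where
  ⊆-union : ∀ {Γ} → SignSymmetric Γ → ∃[ r ] 𝕊[ suc r ] G Γ
  ⊆-union {Γ} symmetric with weak⇒principal Γ (signSymmetric⇒weak Γ symmetric)
  ... | k , φ , principal@(weak , (0<k , φᵏ≈id , _) , _)
      with weak-evenOrder Γ conn ¬bip φ weak k φᵏ≈id
  -- An order is positive, so the quotient by 2 is some `suc r`, matching a union that starts at
  -- `𝕊[ 1 ]`.
  ...   | divides zero refl    = contradiction 0<k λ ()
  ...   | divides (suc r) refl = r , symmetric , φ ,
          subst (λ k → PrincipalOfOrder Γ k φ) (*-comm (suc r) 2) principal
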